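{- Let $P$ be a countable meet-continuous dcpo with binary meets, and let $(p_n)_{n\in\mathbb N}$ be an ascending sequence $p_0\le p_1\le\cdots$ in $P$ with supremum $r$. For every nonempty $S\subseteq\mathord{\downarrow}r$, there exist $t\in S$ and $m\in\mathbb N$ such that \[ \{y\in S:\ y\wedge p_m=t\wedge p_m\}=\{t\}. \]
   Context: All posets and directed sets are nonempty; countable sets may be finite; $\mathbb N=\{0,1,2,\ldots\}$. A subset $D$ of a poset is directed if any two of its elements have a common upper bound in $D$. A dcpo is a poset in which every directed subset has a supremum. Write $\mathord{\downarrow}x=\{y:y\le x\}$ and $\mathord{\downarrow}A=\bigcup_{a\in A}\mathord{\downarrow}a$. An upper set $U\subseteq P$ is Scott open if for every directed $D\subseteq P$, $\bigvee D\in U$ implies $D\cap U\neq\emptyset$; the Scott open sets form the Scott topology $\sigma(P)$. A dcpo $P$ is meet-continuous if for every $x\in P$ and every directed $D\subseteq P$, $x\le\bigvee D$ implies $x\in\operatorname{cl}_{\sigma(P)}(\mathord{\downarrow}x\cap\mathord{\downarrow}D)$, where $\operatorname{cl}_{\sigma(P)}$ is closure in the Scott topology. $x\wedge y$ denotes the binary meet (greatest lower bound) in $P$. -}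

module Defs where

open import Level using (Level; _⊔_; suc)
open import Data.Nat.Base using (ℕ)
open import Data.Product.Base using (_×_; ∃-syntax)
open import Function.Bundles using (Injection)
open import Relation.Binary.Bundles using (Setoid; Poset)
open import Relation.Binary.Definitions using (_Respects_)
open import Relation.Binary.PropositionalEquality.Properties using (setoid)
open import Relation.Unary using (Pred; _∈_; _⊆_; _∩_; ∁; Satisfiable)

-- Finite setoids are countable in this sense.
Countable : ∀ {a ℓ} → Setoid a ℓ → Set (a ⊔ ℓ)
Countable A = Injection A (setoid ℕ)

-- Subsets of a poset are predicates at the level c ⊔ ℓ₁ ⊔ ℓ₂ of the poset
-- itself. Directed subsets need not respect _≈_: closing a subset under _≈_
-- changes neither its directedness, nor its suprema, nor whether it meets a
-- given upper set.
module Domain {c ℓ₁ ℓ₂ : Level} (P : Poset c ℓ₁ ℓ₂) where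

  open Poset P

  Subset : Set (suc (c ⊔ ℓ₁ ⊔ ℓ₂))
  Subset = Pred Carrier (c ⊔ ℓ₁ ⊔ ℓ₂)

  ↓_ : Carrier → Pred Carrier ℓ₂
  ↓ x = λ y → y ≤ x

  ⇓_ : Subset → Subset
  ⇓ A = λ y → ∃[ a ] (a ∈ A × y ∈ ↓ a)

  Range : (ℕ → Carrier) → Pred Carrier ℓ₁
  Range p = λ x → ∃[ n ] x ≈ p n

  record IsDirected (D : Subset) : Set (c ⊔ ℓ₁ ⊔ ℓ₂) where
    field
      nonempty    : Satisfiable D
      upper-bound : ∀ {x y} → x ∈ D → y ∈ D → ∃[ z ] (z ∈ D × x ≤ z × y ≤ z)

  record IsSupremum {ℓ : Level} (A : Pred Carrier ℓ) (s : Carrier)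
                    : Set (c ⊔ ℓ₂ ⊔ ℓ) where
    field
      upper : ∀ {x} → x ∈ A → x ≤ s
      least : ∀ {u} → (∀ {x} → x ∈ A → x ≤ u) → s ≤ u

  IsDCPO : Set (suc (c ⊔ ℓ₁ ⊔ ℓ₂))
  IsDCPO = ∀ (D : Subset) → IsDirected D → ∃[ s ] IsSupremum D s

  record ScottOpen (U : Subset) : Set (suc (c ⊔ ℓ₁ ⊔ ℓ₂)) where
    field
      upper-set    : U Respects _≤_
      inaccessible : ∀ (D : Subset) → IsDirected D → ∀ {s} → IsSupremum D s →
                     s ∈ U → Satisfiable (D ∩ U)

  ScottClosed : Subset → Set (suc (c ⊔ ℓ₁ ⊔ ℓ₂))
  ScottClosed C = ScottOpen (∁ C)

  cl : Subset → Pred Carrier (suc (c ⊔ ℓ₁ ⊔ ℓ₂))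
  cl A = λ x → ∀ (C : Subset) → ScottClosed C → A ⊆ C → x ∈ C

  IsMeetContinuous : Set (suc (c ⊔ ℓ₁ ⊔ ℓ₂))
  IsMeetContinuous = ∀ (x : Carrier) (D : Subset) → IsDirected D →
                     ∀ {s} → IsSupremum D s → x ≤ s → x ∈ cl (↓ x ∩ ⇓ D)

{-# OPTIONS --safe #-}

-- Suppose that no t and m are as required. Regard two elements as close when
-- their meets with p m agree for a large m. Meet-continuity makes this relation
-- separated on ↓ r and makes the sequences t₀ ∧ p m₀ ≤ t₁ ∧ p m₁ ≤ … arising
-- from nested balls converge to a point of all the balls. As S then has no
-- isolated point, Cantor's diagonal argument applies: the balls can be chosen
-- such that the k-th one excludes the element of ↓ r with code k, so the limit
-- has no code.

module Submission where

open import Defs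
open import Level using (Level; _⊔_; Lift; lift; lower)
open import Axiom.ExcludedMiddle using (ExcludedMiddle)
open import Axiom.DoubleNegationElimination using (em⇒dne)
open import Data.Nat.Base as ℕ using (ℕ; zero; suc; _≤′_; ≤′-refl; ≤′-step)
open import Data.Nat.Properties as ℕ using (≤⇒≤′)
open import Data.Product.Base using (_×_; ∃-syntax; _,_; proj₁; proj₂)
open import Data.Sum.Base using (inj₁; inj₂)
open import Function.Bundles using (module Injection)
open import Relation.Binary.Bundles using (module Poset)
open import Relation.Binary.Definitions using (_Respects_)
open import Relation.Binary.Lattice.Bundles using (MeetSemilattice)
import Relation.Binary.Lattice.Properties.MeetSemilattice as MeetSemilatticeProperties
open import Relation.Binary.PropositionalEquality.Core using (_≡_; refl; sym; trans)
open import Relation.Nullary.Decidable.Core using (Dec; yes; no; map′; decidable-stable)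
open import Relation.Nullary.Negation.Core using (¬_)
open import Relation.Unary using (_∈_; _⊆_; _∩_; _≐_; Satisfiable)

lowerEM : ∀ {a} b → ExcludedMiddle (a ⊔ b) → ExcludedMiddle a
lowerEM b em {A} = map′ lower lift (em {Lift b A})

module _ {c ℓ₁ ℓ₂ : Level} (em : ExcludedMiddle (c ⊔ ℓ₁ ⊔ ℓ₂))
         (P : MeetSemilattice c ℓ₁ ℓ₂) where

  open MeetSemilattice P renaming (refl to ≤-refl; trans to ≤-trans)
  open MeetSemilatticeProperties P using (∧-monotonic; ∧-cong)
  open Domain poset

  Ascending : (ℕ → Carrier) → Set ℓ₂
  Ascending d = ∀ n → d n ≤ d (suc n)

  ascending⇒monotone : ∀ {d} → Ascending d → ∀ {i j} → i ℕ.≤ j → d i ≤ d j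
  ascending⇒monotone {d} asc i≤j = go (≤⇒≤′ i≤j)
    where
    go : ∀ {i j} → i ≤′ j → d i ≤ d j
    go ≤′-refl       = ≤-refl
    go (≤′-step i≤j) = ≤-trans (go i≤j) (asc _)

  -- `Range d` lives at level `ℓ₁`, whereas directed sets are taken among the larger `Subset`.
  LiftedRange : (ℕ → Carrier) → Subset
  LiftedRange d x = Lift (c ⊔ ℓ₂) (x ∈ Range d)

  liftedRange-directed : ∀ {d} → Ascending d → IsDirected (LiftedRange d)
  liftedRange-directed {d} asc = record
    { nonempty    = d 0 , lift (0 , Eq.refl)
    ; upper-bound = λ { (lift (i , x≈dᵢ)) (lift (j , y≈dⱼ)) →
        d (i ℕ.⊔ j) , lift (i ℕ.⊔ j , Eq.refl) ,
        ≤-trans (reflexive x≈dᵢ) (ascending⇒monotone asc (ℕ.m≤m⊔n i j)) ,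
        ≤-trans (reflexive y≈dⱼ) (ascending⇒monotone asc (ℕ.m≤n⊔m i j)) }
    }

  liftedRange-supremum : ∀ {d s} → IsSupremum (Range d) s →
                         IsSupremum (LiftedRange d) s
  liftedRange-supremum sup = record
    { upper = λ x∈ → IsSupremum.upper sup (lower x∈)
    ; least = λ ub → IsSupremum.least sup (λ x∈ → ub (lift x∈))
    }

  module _ (meet-continuous : IsMeetContinuous) where

    private
      LiftedDownset : Carrier → Subset
      LiftedDownset u y = Lift (c ⊔ ℓ₁) (y ≤ u)

      liftedDownset-closed : ∀ u → ScottClosed (LiftedDownset u)
      liftedDownset-closed u = record
        { upper-set    = λ y≤z y≰u z≤u → y≰u (lift (≤-trans y≤z (lower z≤u)))
        ; inaccessible = λ D _ sup s≰u → em⇒dne em λ none →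
            s≰u (lift (IsSupremum.least sup λ {d} d∈D →
              decidable-stable (lowerEM (c ⊔ ℓ₁) em) λ d≰u →
                none (d , d∈D , λ d≤u → d≰u (lower d≤u))))
        }

    -- An element below both `x` and some `d n` is below `x ∧ d n`, hence below `u`. So the Scott
    -- closed set of elements below `u` contains the set whose closure contains `x` by
    -- meet-continuity. This is applied both to `p` and to the approximants of a limit.
    ≤-from-meets : ∀ {d} → Ascending d → ∀ {s} → IsSupremum (LiftedRange d) s →
                   ∀ {x u} → x ≤ s → (∀ n → x ∧ d n ≤ u) → x ≤ u
    ≤-from-meets {d} asc sup {x} {u} x≤s below = lower
      (meet-continuous x (LiftedRange d) (liftedRange-directed asc) sup x≤s
        (LiftedDownset u) (liftedDownset-closed u)
        λ { (y≤x , a , lift (n , a≈dₙ) , y≤a) →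
            lift (≤-trans (∧-greatest y≤x (≤-trans y≤a (reflexive a≈dₙ)))
                          (below n)) })

    module _ {p : ℕ → Carrier} (p-asc : Ascending p)
             {r : Carrier} (p-sup : IsSupremum (Range p) r) where

      infix 4 _≈[_]_
      _≈[_]_ : Carrier → ℕ → Carrier → Set ℓ₁
      x ≈[ m ] y = x ∧ p m ≈ y ∧ p m

      -- Since `p i ≤ p j`, meeting both sides with `p i` turns agreement at `j` into agreement at
      -- `i`.
      coarsen : ∀ {x y i j} → i ℕ.≤ j → x ≈[ j ] y → x ≈[ i ] y
      coarsen {i = i} {j} i≤j eq = antisym (half eq) (half (Eq.sym eq))
        where
        half : ∀ {x y} → x ≈[ j ] y → x ∧ p i ≤ y ∧ p i
        half eq = ∧-greatest
          (≤-trans (∧-monotonic ≤-refl (ascending⇒monotone p-asc i≤j))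
                   (≤-trans (reflexive eq) (x∧y≤x _ _)))
          (x∧y≤y _ _)

      -- Each `x ∧ p m` equals `y ∧ p m` and so lies below `y`; as `x` is below the supremum of `p`,
      -- this gives `x ≤ y`, and symmetrically.
      separated : ∀ {x y} → x ≤ r → y ≤ r → (∀ m → x ≈[ m ] y) → x ≈ y
      separated x≤r y≤r eq =
        antisym (half x≤r eq) (half y≤r (λ m → Eq.sym (eq m)))
        where
        half : ∀ {x y} → x ≤ r → (∀ m → x ≈[ m ] y) → x ≤ y
        half x≤r eq = ≤-from-meets p-asc (liftedRange-supremum p-sup) x≤r
          λ m → ≤-trans (reflexive (eq m)) (x∧y≤x _ _)

      distinguish : ∀ {x y} → x ≤ r → y ≤ r → ¬ x ≈ y → ∃[ m ] ¬ x ≈[ m ] y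
      distinguish x≤r y≤r x≉y = decidable-stable (lowerEM (c ⊔ ℓ₂) em) λ none →
        x≉y (separated x≤r y≤r λ m →
          decidable-stable (lowerEM (c ⊔ ℓ₂) em) λ neq → none (m , neq))

      -- The centres `t k` need not ascend, but their truncations `z k` do, because `t k` and
      -- `t (suc k)` have the same meet with `p (m k)`. The supremum of the truncations is the
      -- common point.
      nested-balls-meet : IsDCPO →
        (t : ℕ → Carrier) → (∀ k → t k ≤ r) →
        (m : ℕ → ℕ) → (∀ k → m k ℕ.≤ m (suc k)) →
        (∀ k → t (suc k) ≈[ m k ] t k) →
        ∃[ x ] (x ≤ r × ∀ k → x ≈[ m k ] t k)
      nested-balls-meet dcpo t t≤r m m-step t-step =
        x , x≤r , λ k → antisym (x∧p≤t∧p k) (t∧p≤x∧p k)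
        where
        z : ℕ → Carrier
        z k = t k ∧ p (m k)

        z-asc : Ascending z
        z-asc k = ≤-trans (reflexive (Eq.sym (t-step k)))
          (∧-monotonic ≤-refl (ascending⇒monotone p-asc (m-step k)))

        x : Carrier
        x = proj₁ (dcpo (LiftedRange z) (liftedRange-directed z-asc))

        x-sup : IsSupremum (LiftedRange z) x
        x-sup = proj₂ (dcpo (LiftedRange z) (liftedRange-directed z-asc))

        x≤r : x ≤ r
        x≤r = IsSupremum.least x-sup λ { (lift (k , a≈zₖ)) →
          ≤-trans (reflexive a≈zₖ) (≤-trans (x∧y≤x _ _) (t≤r k)) }

        m-mono : ∀ {i j} → i ≤′ j → m i ℕ.≤ m j
        m-mono ≤′-refl       = ℕ.≤-refl
        m-mono (≤′-step i≤j) = ℕ.≤-trans (m-mono i≤j) (m-step _)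

        t-stable : ∀ {i j} → i ≤′ j → t j ≈[ m i ] t i
        t-stable ≤′-refl       = Eq.refl
        t-stable (≤′-step i≤j) =
          Eq.trans (coarsen (m-mono i≤j) (t-step _)) (t-stable i≤j)

        -- Early truncations are below `z k` by monotonicity; for later ones, `t j` and `t k` agree
        -- at index `m k`.
        z∧p≤z : ∀ j k → z j ∧ p (m k) ≤ z k
        z∧p≤z j k with ℕ.≤-total j k
        ... | inj₁ j≤k = ≤-trans (x∧y≤x _ _) (ascending⇒monotone z-asc j≤k)
        ... | inj₂ k≤j = ≤-trans (∧-monotonic (x∧y≤x _ _) ≤-refl)
                                 (reflexive (t-stable (≤⇒≤′ k≤j)))

        x∧p≤t∧p : ∀ k → x ∧ p (m k) ≤ z k
        -- As `x` is the supremum of `z`, it suffices to bound the meet of `x ∧ p (m k)` with each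
        -- `z j`.
        x∧p≤t∧p k = ≤-from-meets z-asc x-sup (x∧y≤x _ _) λ j →
          ≤-trans (∧-greatest (x∧y≤y _ _) (≤-trans (x∧y≤x _ _) (x∧y≤y _ _)))
                  (z∧p≤z j k)

        t∧p≤x∧p : ∀ k → z k ≤ x ∧ p (m k)
        t∧p≤x∧p k =
          ∧-greatest (IsSupremum.upper x-sup (lift (k , Eq.refl))) (x∧y≤y _ _)

      module _ (countable : Countable (Poset.Eq.setoid poset)) (dcpo : IsDCPO)
               {S : Subset} (S⊆↓r : S ⊆ (↓ r)) where

        open Injection countable using (injective) renaming (to to code)

        Crowded : Set (c ⊔ ℓ₁ ⊔ ℓ₂)
        Crowded = ∀ {t} → t ∈ S → ∀ m → ∃[ y ] (y ∈ S × y ≈[ m ] t × ¬ y ≈ t)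

        private
          Ball : Set (c ⊔ ℓ₁ ⊔ ℓ₂)
          Ball = ∃[ t ] (t ∈ S × ℕ)

          centre : Ball → Carrier
          centre (t , _) = t

          index : Ball → ℕ
          index (_ , _ , m) = m

          -- The first two conditions place the new ball inside the old one. The third quantifies
          -- over all elements with code `k`, so it is vacuous if there are none.
          Shrinks : ℕ → Ball → Ball → Set (c ⊔ ℓ₁ ⊔ ℓ₂)
          Shrinks k (t , _ , m) (t′ , _ , m′) =
            m ℕ.≤ m′ × t′ ≈[ m ] t ×
            (∀ {x} → x ≤ r → code x ≡ k → ¬ x ≈[ m′ ] t′)

        -- If `e` has code `k`, a centre different from `e` is found in the old ball, using
        -- crowdedness when the old centre is `e` itself; a large enough index then separates the
        -- two.
        shrink : Crowded → ∀ k B → ∃[ B′ ] Shrinks k B B′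
        shrink crowded k B@(t , t∈S , m)
          with lowerEM ℓ₁ em {∃[ e ] (e ≤ r × code e ≡ k)}
        ... | no none =
          B , ℕ.≤-refl , Eq.refl , λ x≤r x≡k _ → none (_ , x≤r , x≡k)
        ... | yes (e , e≤r , e≡k) = exclude (avoid (lowerEM (c ⊔ ℓ₂) em))
          where
          avoid : Dec (t ≈ e) → ∃[ t′ ] (t′ ∈ S × t′ ≈[ m ] t × ¬ t′ ≈ e)
          avoid (no t≉e)  = t , t∈S , Eq.refl , t≉e
          avoid (yes t≈e) with crowded t∈S m
          ... | y , y∈S , y≈t , y≉t =
            y , y∈S , y≈t , λ y≈e → y≉t (Eq.trans y≈e (Eq.sym t≈e))

          exclude : ∃[ t′ ] (t′ ∈ S × t′ ≈[ m ] t × ¬ t′ ≈ e) →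
                    ∃[ B′ ] Shrinks k B B′
          exclude (t′ , t′∈S , t′≈t , t′≉e) with distinguish (S⊆↓r t′∈S) e≤r t′≉e
          -- The bound `m` keeps the new ball inside the old one, and `j` tells `t′` from `e`. By
          -- injectivity any `x` with code `k` equals `e`.
          ... | j , neq =
            (t′ , t′∈S , m ℕ.⊔ j) , ℕ.m≤m⊔n m j , t′≈t , λ x≤r x≡k eq →
              neq (Eq.trans (Eq.sym (coarsen (ℕ.m≤n⊔m m j) eq))
                (∧-cong (injective (trans x≡k (sym e≡k))) Eq.refl))

        ¬crowded : Satisfiable S → ¬ Crowded
        ¬crowded (t₀ , t₀∈S) crowded = contradict
          (nested-balls-meet dcpo
            (λ k → centre (ball k)) (λ k → S⊆↓r (proj₁ (proj₂ (ball k))))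
            (λ k → index (ball k)) (λ k → proj₁ (shrinks k))
            (λ k → proj₁ (proj₂ (shrinks k))))
          where
          ball : ℕ → Ball
          ball zero    = t₀ , t₀∈S , 0
          ball (suc k) = proj₁ (shrink crowded k (ball k))

          shrinks : ∀ k → Shrinks k (ball k) (ball (suc k))
          shrinks k = proj₂ (shrink crowded k (ball k))

          contradict : ¬ (∃[ x ] (x ≤ r ×
                            ∀ k → x ≈[ index (ball k) ] centre (ball k)))
          -- Stage `k` yields ball `suc k`, so `x` is excluded from the ball numbered one above its
          -- code.
          contradict (x , x≤r , x∈ball) =
            proj₂ (proj₂ (shrinks (code x))) x≤r refl (x∈ball (suc (code x)))

lemma6p1 : {c ℓ₁ ℓ₂ : Level} → ExcludedMiddle (c ⊔ ℓ₁ ⊔ ℓ₂) →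
    (P : MeetSemilattice c ℓ₁ ℓ₂) →
    let open MeetSemilattice P
        open Domain poset
    in
    Countable (Poset.Eq.setoid poset) →
    IsDCPO →
    IsMeetContinuous →
    (p : ℕ → Carrier) → (∀ n → p n ≤ p (suc n)) →
    (r : Carrier) → IsSupremum (Range p) r →
    (S : Subset) → S Respects _≈_ → Satisfiable S → S ⊆ (↓ r) →
    ∃[ t ] ∃[ m ] (t ∈ S × ((S ∩ (λ y → (y ∧ p m) ≈ (t ∧ p m))) ≐ (λ y → y ≈ t)))
lemma6p1 {c} {_} {ℓ₂} em P countable dcpo mc p p-asc r p-sup S S-resp S-nonempty S⊆↓r =
  em⇒dne em λ none →
    ¬crowded em P mc p-asc p-sup countable dcpo S⊆↓r S-nonempty
      -- If `t` had no other point of `S` in its ball of index `m`, then `t` and `m` would be as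
      -- required.
      λ {t} t∈S m → em⇒dne em λ isolated → none
        (t , m , t∈S ,
          (λ { {y} (y∈S , y≈ₘt) → decidable-stable (lowerEM (c ⊔ ℓ₂) em) λ y≉t →
               isolated (y , y∈S , y≈ₘt , y≉t) }) ,
          (λ { {y} y≈t → S-resp (Eq.sym y≈t) t∈S , ∧-cong y≈t Eq.refl }))
  where
  open MeetSemilattice P using (module Eq)
  open MeetSemilatticeProperties P using (∧-cong)
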